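{- Let $n\ge 2$. Then $a_0$ divides $DD_{n,1}$ in $\mathbb{Z}[a_0,a_2,a_3,\ldots,a_n]$.
   Context: Let $a_0,\ldots,a_n$ be independent indeterminates, $f(x)=\sum_{i=0}^n a_ix^i$, and let $D_n\in\mathbb{Z}[a_0,\ldots,a_n]$ be its discriminant (normalized so that for $f=a_n\prod_{i=1}^n(x-r_i)$, $D_n=a_n^{2n-2}\prod_{i<j}(r_i-r_j)^2$). The double discriminant is $DD_{n,k}=\operatorname{disc}_{a_k}(D_n)\in\mathbb{Z}[a_i: i\neq k]$, the discriminant of $D_n$ regarded as a polynomial in the single variable $a_k$, with the normalization $\operatorname{disc} g=c^{2d-2}\prod_{i<j}(\rho_i-\rho_j)^2$ for $g$ of degree $d$, leading coefficient $c$, roots $\rho_i$. -}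

module Defs where

open import Data.Bool using (Bool; true; false; if_then_else_; _∧_)
open import Data.Nat as ℕ using (ℕ; zero; suc; _∸_; _≤ᵇ_; _<ᵇ_)
open import Data.Integer as ℤ using (ℤ)
open import Data.List using (List; []; _∷_; map; foldr; length; upTo)
open import Data.Fin using (Fin; toℕ; punchIn)
import Data.Fin as Fin
open import Data.Product using (∃)
open import Relation.Binary.PropositionalEquality using (_≡_)

evenᵇ : ℕ → Bool
evenᵇ zero = true
evenᵇ (suc zero) = false
evenᵇ (suc (suc k)) = evenᵇ k

record ZRing : Set₁ where
  infixl 6 _+_
  infixl 7 _*_
  field
    Carrier : Set
    0# 1#   : Carrier
    _+_ _*_ : Carrier → Carrier → Carrier
    -_      : Carrier → Carrier
    isZero  : Carrier → Bool

ℤ-ring : ZRing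
ℤ-ring = record
  { Carrier = ℤ ; 0# = ℤ.0ℤ ; 1# = ℤ.1ℤ ; _+_ = ℤ._+_ ; _*_ = ℤ._*_
  ; -_ = ℤ.-_ ; isZero = λ z → ℤ.∣ z ∣ ℕ.≡ᵇ 0 }

-- Dense univariate polynomials over R: coefficient lists c₀ ∷ c₁ ∷ …
-- (constant term first).  Not necessarily normalised.

module UPoly (R : ZRing) where
  open ZRing R

  addL : List Carrier → List Carrier → List Carrier
  addL [] ys = ys
  addL (x ∷ xs) [] = x ∷ xs
  addL (x ∷ xs) (y ∷ ys) = (x + y) ∷ addL xs ys

  scaleL : Carrier → List Carrier → List Carrier
  scaleL c = map (c *_)

  mulL : List Carrier → List Carrier → List Carrier
  mulL [] ys = []
  mulL (x ∷ xs) ys = addL (scaleL x ys) (0# ∷ mulL xs ys)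

  negL : List Carrier → List Carrier
  negL = map -_

  isZeroL : List Carrier → Bool
  isZeroL [] = true
  isZeroL (x ∷ xs) = isZero x ∧ isZeroL xs

  strip : List Carrier → List Carrier
  strip [] = []
  strip (x ∷ xs) with strip xs
  ... | [] = if isZero x then [] else x ∷ []
  ... | r@(_ ∷ _) = x ∷ r

  fromℕ : ℕ → Carrier
  fromℕ zero = 0#
  fromℕ (suc k) = 1# + fromℕ k

  coeff : List Carrier → ℕ → Carrier
  coeff [] _ = 0#
  coeff (x ∷ xs) zero = x
  coeff (x ∷ xs) (suc k) = coeff xs k

  deriv : List Carrier → List Carrier
  deriv [] = []
  deriv (_ ∷ xs) = go 1 xs
    where
    go : ℕ → List Carrier → List Carrier
    go k [] = []
    go k (c ∷ cs) = (fromℕ k * c) ∷ go (suc k) cs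

  -- degree and leading coefficient (of the normalised polynomial;
  -- for the zero polynomial: degree 0, leading coefficient 0)
  degree : List Carrier → ℕ
  degree p = length (strip p) ∸ 1

  lc : List Carrier → Carrier
  lc p = coeff (strip p) (degree p)

  altSum : ∀ k → (Fin k → Carrier) → Carrier
  altSum zero f = 0#
  altSum (suc k) f = f Fin.zero + - altSum k (λ j → f (Fin.suc j))

  det : ∀ k → (Fin k → Fin k → Carrier) → Carrier
  det zero M = 1#
  det (suc k) M =
    altSum (suc k) (λ j → M Fin.zero j * det k (λ r c → M (Fin.suc r) (punchIn j c)))

  -- Sylvester matrix of p (degree d) and q (degree e), size d + e,
  -- coefficients written in descending order; first e rows from p.
  sylvester : (p q : List Carrier) →
              Fin (degree p ℕ.+ degree q) → Fin (degree p ℕ.+ degree q) → Carrier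
  sylvester p q r c =
    if toℕ r <ᵇ e then row p d (toℕ r) else row q e (toℕ r ∸ e)
    where
    d = degree p
    e = degree q
    row : List Carrier → ℕ → ℕ → Carrier
    row s m i = if (i ≤ᵇ toℕ c) ∧ ((toℕ c ∸ i) ≤ᵇ m)
                then coeff (strip s) (m ∸ (toℕ c ∸ i)) else 0#

  -- resultant Res(p, q) = det Syl(p, q)  (= lc(p)^deg q · ∏ q(ρᵢ))
  resultant : List Carrier → List Carrier → Carrier
  resultant p q = det (degree p ℕ.+ degree q) (sylvester p q)

  -- (-1)^(d(d-1)/2)
  -- uses d(d+1)/2 = d(d-1)/2 + d
  signDisc : ℕ → Carrier
  signDisc zero = 1#
  signDisc (suc d) = if evenᵇ d then signDisc d else - signDisc d

-- Multivariate polynomials over ℤ in m variables, nested representation: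
-- P 0 = ℤ, P (suc m) = List (P m).  In P (suc m) the outer variable
-- has index 0, and variable (suc i) is variable i of the coefficients.

PolyOver : ZRing → ZRing
PolyOver R = record
  { Carrier = List Carrier ; 0# = [] ; 1# = 1# ∷ []
  ; _+_ = addL ; _*_ = mulL ; -_ = negL ; isZero = isZeroL }
  where open ZRing R
        open UPoly R

PR : ℕ → ZRing
PR zero = ℤ-ring
PR (suc m) = PolyOver (PR m)

P : ℕ → Set
P m = ZRing.Carrier (PR m)

eval : ∀ m → P m → (ℕ → ℤ) → ℤ
eval zero z ρ = z
eval (suc m) cs ρ = foldr (λ c acc → eval m c (λ i → ρ (suc i)) ℤ.+ ρ 0 ℤ.* acc) ℤ.0ℤ cs

-- equality as polynomials (ℤ is an infinite integral domain, so equality of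
-- polynomial functions on ℤ^m is equality in ℤ[x₀,…,x_{m-1}])
PolyEq : ∀ m → P m → P m → Set
PolyEq m p q = ∀ (ρ : ℕ → ℤ) → eval m p ρ ≡ eval m q ρ

-- variable with index i (the zero polynomial if i ≥ m)
var : ∀ m → ℕ → P m
var zero _ = ℤ.0ℤ
var (suc m) zero = ZRing.0# (PR m) ∷ ZRing.1# (PR m) ∷ []
var (suc m) (suc i) = var m i ∷ []

-- Discriminant.  For g ∈ R[t] of degree d with leading coefficient c,
-- disc g is characterised (R an integral domain, c ≠ 0) by
--   c · disc g = (-1)^(d(d-1)/2) · Res(g, g').
-- IsDisc m g D : D ∈ P m is the discriminant of g ∈ (P m)[t] = P (suc m).

IsDisc : ∀ m → P (suc m) → P m → Set
IsDisc m g D =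
  PolyEq m (lc g * D) (signDisc (degree g) * resultant g (deriv g))
  where open ZRing (PR m)
        open UPoly (PR m)

Divides : ∀ m → P m → P m → Set
Divides m a b = ∃ λ (q : P m) → PolyEq m (a * q) b
  where open ZRing (PR m)

-- The generic polynomial f(x) = Σ_{i=0}^n aᵢ xⁱ, with coefficients in
-- S = P (suc n) = ℤ[a₀,…,aₙ], variable order chosen so that a₁ is the
-- outermost variable of S:   S-index 0 ↦ a₁, 1 ↦ a₀, k ≥ 2 ↦ a_k.
-- Hence S = R[a₁] with R = P n = ℤ[a₀,a₂,…,aₙ], R-index 0 ↦ a₀,
-- R-index i ≥ 1 ↦ a_{i+1}.

aIndex : ℕ → ℕ
aIndex zero = 1
aIndex (suc zero) = 0
aIndex k@(suc (suc _)) = k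

a : ∀ n → ℕ → P (suc n)
a n i = var (suc n) (aIndex i)

genericPoly : ∀ n → P (suc (suc n))
genericPoly n = map (a n) (upTo (suc n))

a₀ᴿ : ∀ n → P n
a₀ᴿ n = var n 0

{-# OPTIONS --safe #-}
module Submission where

-- At a₀ = 0 the last two columns of the Sylvester matrix of f and f′ show that
-- aₙ Dₙ, hence Dₙ, is divisible by a₁²; it does not vanish there, since for
-- f = xⁿ + x the derivative is 1 modulo n and the Sylvester matrix is
-- unitriangular modulo n.  So Dₙ has degree at least 2 in a₁ and its two lowest
-- coefficients d₀, d₁ vanish at a₀ = 0.  In the Sylvester matrix of Dₙ and its
-- derivative the first column is a multiple of the leading coefficient and the
-- last one has entries in {0, d₀, d₁}.  Cancelling the former, DDₙ,₁ vanishes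
-- at a₀ = 0.
--
-- All of this happens on integer values.  Cancelling a nonzero polynomial L at
-- a zero ρ of L is done by moving to points σ ≡ ρ (mod N) with L(σ) ≠ 0, for
-- every N: an integer divisible by all N is 0.

open import Defs
open import Data.Bool using (Bool; true; false; if_then_else_; _∧_; T)
import Data.Bool.Properties as Bool
open import Data.Empty using (⊥-elim)
open import Data.Fin as Fin using (Fin; toℕ; punchIn; punchOut; fromℕ; inject₁)
import Data.Fin.Properties as Fin
open import Data.Integer as ℤ using (ℤ; +_; -[1+_]; 0ℤ; 1ℤ)
open import Data.Integer.Divisibility.Signed
import Data.Integer.Properties as ℤ
open import Data.Integer.Tactic.RingSolver using (solve-∀)
open import Data.List using (List; []; _∷_; map; length; applyUpTo)
open import Data.Nat as ℕ using (ℕ; zero; suc; _≤_; _∸_; _≤ᵇ_; _<ᵇ_; s≤s; z≤n)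
open import Data.Nat.Divisibility using () renaming (∣⇒≤ to ∣ℕ⇒≤)
import Data.Nat.Properties as ℕ
open import Data.Product using (∃; _×_; _,_; proj₁; proj₂)
open import Data.Sum using ([_,_]′)
open import Function using (_∘_; id)
open import Function.Bundles using (Equivalence)
open import Relation.Binary.Definitions using (tri<; tri≈; tri>)
open import Relation.Binary.PropositionalEquality
open import Relation.Nullary using (yes; no)

open ≡-Reasoning

-- Divisibility of integers

∣0 : ∀ {N} → N ∣ 0ℤ
∣0 = divides 0ℤ refl

∣-self : ∀ {N} x → N ∣ x ℤ.- x
∣-self {N} x = subst (N ∣_) (sym (ℤ.+-inverseʳ x)) ∣0

*-mono-∣ : ∀ {x y u v} → x ∣ u → y ∣ v → x ℤ.* y ∣ u ℤ.* v
*-mono-∣ {x} {y} {u} {v} x∣u y∣v = ∣-trans (*-monoˡ-∣ y x∣u) (*-monoʳ-∣ u y∣v)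

∣-difference⇒∣ : ∀ {N x y} → N ∣ x ℤ.- y → N ∣ x → N ∣ y
∣-difference⇒∣ {N} {x} {y} N∣x-y N∣x = subst (N ∣_) (cancel x y) (∣m∣n⇒∣m-n N∣x N∣x-y)
  where
  cancel : ∀ x y → x ℤ.- (x ℤ.- y) ≡ y
  cancel = solve-∀

-- Meant for a leading coefficient `L`, a discriminant `y` and a resultant `r`: as `r` contains the
-- factor `L` as well, `y` equals `s * x`.
∣-cancel-factor : ∀ {N} L s x y r → L ≢ 0ℤ → L ℤ.* y ≡ s ℤ.* r → r ≡ L ℤ.* x → N ∣ x → N ∣ y
∣-cancel-factor {N} L s x y r L≢0 eq refl N∣x = subst (N ∣_)
  (ℤ.*-cancelˡ-≡ L (s ℤ.* x) y {{ℤ.≢-nonZero L≢0}} (trans (swap L s x) (sym eq)))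
  (∣n⇒∣m*n s N∣x)
  where
  swap : ∀ L s x → L ℤ.* (s ℤ.* x) ≡ s ℤ.* (L ℤ.* x)
  swap = solve-∀

+suc≢0 : ∀ {k} → + suc k ≢ 0ℤ
+suc≢0 ()

∣-by-all⇒≡0 : ∀ {x} → (∀ k → + suc k ∣ x) → x ≡ 0ℤ
∣-by-all⇒≡0 {+ zero} _ = refl
-- `h (suc k)` is about the modulus `+ suc (suc k)`, one more than the absolute value of the nonzero
-- integer.
∣-by-all⇒≡0 {+ suc k} h = ⊥-elim (ℕ.1+n≰n (∣ℕ⇒≤ (∣⇒∣ᵤ (h (suc k)))))
∣-by-all⇒≡0 { -[1+ k ]} h = ⊥-elim (ℕ.1+n≰n (∣ℕ⇒≤ (∣⇒∣ᵤ (h (suc k)))))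

-- Every positive `t` divides `x`, so `x` is zero; then one `t` cancels and every positive `t`
-- divides `y`. This turns divisibility at all integer values of a variable into the vanishing of
-- two coefficients.
square-∣-linear : ∀ {x y} → (∀ t → t ℤ.* t ∣ x ℤ.+ t ℤ.* y) → x ≡ 0ℤ × y ≡ 0ℤ
square-∣-linear {x} {y} h = x≡0 , y≡0
  where
  x≡0 : x ≡ 0ℤ
  x≡0 = ∣-by-all⇒≡0 (λ k → ∣m+n∣n⇒∣m {m = x}
    (∣-trans (∣m⇒∣m*n (+ suc k) ∣-refl) (h (+ suc k))) (∣m⇒∣m*n y ∣-refl))

  y≡0 : y ≡ 0ℤ
  y≡0 = ∣-by-all⇒≡0 (λ k → *-cancelˡ-∣ (+ suc k)
    (∣m+n∣m⇒∣n {m = x} (h (+ suc k)) (subst (_ ∣_) (sym x≡0) ∣0)))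

-- Evaluation of polynomials and determinants

module R m = ZRing (PR m)
module U m = UPoly (PR m)

eval-0# : ∀ m ρ → eval m (R.0# m) ρ ≡ 0ℤ
eval-0# zero ρ = refl
eval-0# (suc m) ρ = refl

eval-1# : ∀ m ρ → eval m (R.1# m) ρ ≡ 1ℤ
eval-1# zero ρ = refl
eval-1# (suc m) ρ = begin
  eval m (R.1# m) _ ℤ.+ ρ 0 ℤ.* 0ℤ ≡⟨ cong₂ ℤ._+_ (eval-1# m _) (ℤ.*-zeroʳ (ρ 0)) ⟩
  1ℤ ∎

eval-+ : ∀ m p q ρ → eval m (R._+_ m p q) ρ ≡ eval m p ρ ℤ.+ eval m q ρ
eval-+ zero p q ρ = refl
eval-+ (suc m) [] q ρ = sym (ℤ.+-identityˡ _)
eval-+ (suc m) (x ∷ p) [] ρ = sym (ℤ.+-identityʳ _)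
eval-+ (suc m) (x ∷ p) (y ∷ q) ρ = trans
  (cong₂ (λ u v → u ℤ.+ ρ 0 ℤ.* v) (eval-+ m x y _) (eval-+ (suc m) p q ρ))
  (rearrange (eval m x _) (eval m y _) (ρ 0) _ _)
  where
  rearrange : ∀ x y t p q → (x ℤ.+ y) ℤ.+ t ℤ.* (p ℤ.+ q) ≡ (x ℤ.+ t ℤ.* p) ℤ.+ (y ℤ.+ t ℤ.* q)
  rearrange = solve-∀

eval-neg : ∀ m p ρ → eval m (R.-_ m p) ρ ≡ ℤ.- eval m p ρ
eval-neg zero p ρ = refl
eval-neg (suc m) [] ρ = refl
eval-neg (suc m) (x ∷ p) ρ = trans
  (cong₂ (λ u v → u ℤ.+ ρ 0 ℤ.* v) (eval-neg m x _) (eval-neg (suc m) p ρ))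
  (rearrange (eval m x _) (ρ 0) _)
  where
  rearrange : ∀ x t p → ℤ.- x ℤ.+ t ℤ.* (ℤ.- p) ≡ ℤ.- (x ℤ.+ t ℤ.* p)
  rearrange = solve-∀

eval-* : ∀ m p q ρ → eval m (R._*_ m p q) ρ ≡ eval m p ρ ℤ.* eval m q ρ

eval-scaleL : ∀ m c q ρ → eval (suc m) (U.scaleL m c q) ρ ≡ eval m c (λ i → ρ (suc i)) ℤ.* eval (suc m) q ρ
eval-scaleL m c [] ρ = sym (ℤ.*-zeroʳ (eval m c _))
eval-scaleL m c (x ∷ q) ρ = trans
  (cong₂ (λ u v → u ℤ.+ ρ 0 ℤ.* v) (eval-* m c x _) (eval-scaleL m c q ρ))
  (rearrange (eval m c _) (eval m x _) (ρ 0) _)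
  where
  rearrange : ∀ c x t q → c ℤ.* x ℤ.+ t ℤ.* (c ℤ.* q) ≡ c ℤ.* (x ℤ.+ t ℤ.* q)
  rearrange = solve-∀

eval-* zero p q ρ = refl
eval-* (suc m) [] q ρ = refl
eval-* (suc m) (x ∷ p) q ρ = begin
  eval (suc m) (U.addL m (U.scaleL m x q) (R.0# m ∷ U.mulL m p q)) ρ
    ≡⟨ eval-+ (suc m) (U.scaleL m x q) _ ρ ⟩
  eval (suc m) (U.scaleL m x q) ρ ℤ.+ (eval m (R.0# m) _ ℤ.+ ρ 0 ℤ.* eval (suc m) (U.mulL m p q) ρ)
    ≡⟨ cong₂ ℤ._+_ (eval-scaleL m x q ρ)
         (cong₂ (λ u v → u ℤ.+ ρ 0 ℤ.* v) (eval-0# m _) (eval-* (suc m) p q ρ)) ⟩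
  eval m x _ ℤ.* eval (suc m) q ρ ℤ.+ (0ℤ ℤ.+ ρ 0 ℤ.* (eval (suc m) p ρ ℤ.* eval (suc m) q ρ))
    ≡⟨ rearrange (eval m x _) (ρ 0) (eval (suc m) p ρ) (eval (suc m) q ρ) ⟩
  (eval m x _ ℤ.+ ρ 0 ℤ.* eval (suc m) p ρ) ℤ.* eval (suc m) q ρ ∎
  where
  rearrange : ∀ x t p q → x ℤ.* q ℤ.+ (0ℤ ℤ.+ t ℤ.* (p ℤ.* q)) ≡ (x ℤ.+ t ℤ.* p) ℤ.* q
  rearrange = solve-∀

eval-fromℕ : ∀ m k ρ → eval m (U.fromℕ m k) ρ ≡ + k
eval-fromℕ m zero ρ = eval-0# m ρ
eval-fromℕ m (suc k) ρ = trans (eval-+ m _ _ ρ) (cong₂ ℤ._+_ (eval-1# m ρ) (eval-fromℕ m k ρ))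

eval-altSum : ∀ m k f ρ → eval m (U.altSum m k f) ρ ≡ U.altSum 0 k (λ j → eval m (f j) ρ)
eval-altSum m zero f ρ = eval-0# m ρ
eval-altSum m (suc k) f ρ = trans (eval-+ m (f Fin.zero) _ ρ)
  (cong (λ v → eval m (f Fin.zero) ρ ℤ.+ v)
    (trans (eval-neg m (U.altSum m k _) ρ) (cong ℤ.-_ (eval-altSum m k _ ρ))))

altSum-cong : ∀ k {f g : Fin k → ℤ} → (∀ j → f j ≡ g j) → U.altSum 0 k f ≡ U.altSum 0 k g
altSum-cong zero f≡g = refl
altSum-cong (suc k) f≡g =
  cong₂ (λ u v → u ℤ.+ ℤ.- v) (f≡g Fin.zero) (altSum-cong k (λ j → f≡g (Fin.suc j)))

minor : ∀ {A : Set} {k} → (Fin (suc k) → Fin (suc k) → A) → Fin (suc k) → Fin k → Fin k → A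
minor M j r c = M (Fin.suc r) (punchIn j c)

eval-det : ∀ m k M ρ → eval m (U.det m k M) ρ ≡ U.det 0 k (λ i j → eval m (M i j) ρ)
eval-det m zero M ρ = eval-1# m ρ
eval-det m (suc k) M ρ =
  trans (eval-altSum m (suc k) (λ j → R._*_ m (M Fin.zero j) (U.det m k (minor M j))) ρ)
  (altSum-cong (suc k) (λ j → trans (eval-* m (M Fin.zero j) _ ρ)
    (cong (eval m (M Fin.zero j) ρ ℤ.*_) (eval-det m k (minor M j) ρ))))

-- A copy of the recursion hidden in a where block of deriv.
derivFrom : ∀ m → ℕ → List (P m) → List (P m)
derivFrom m k [] = []
derivFrom m k (c ∷ cs) = R._*_ m (U.fromℕ m k) c ∷ derivFrom m (suc k) cs

-- The two equations determine `G` by recursion on its last argument; `x` and `xs` stand for the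
-- variables captured by the `where` block.
derivFrom-unique :
  ∀ m (G : P m → List (P m) → ℕ → List (P m) → List (P m)) →
  (∀ x xs k → G x xs k [] ≡ []) →
  (∀ x xs k c cs → G x xs k (c ∷ cs) ≡ R._*_ m (U.fromℕ m k) c ∷ G x xs (suc k) cs) →
  ∀ x xs k cs → G x xs k cs ≡ derivFrom m k cs
derivFrom-unique m G nil cons x xs k [] = nil x xs k
derivFrom-unique m G nil cons x xs k (c ∷ cs) =
  trans (cons x xs k c cs) (cong (_ ∷_) (derivFrom-unique m G nil cons x xs (suc k) cs))

-- The recursion inside deriv has no name in scope, so it is found by unification:
-- the with-abstraction makes its arguments and captured variables distinct variables.
mutual
  hiddenRecursion : ∀ m → P m → List (P m) → ℕ → List (P m) → List (P m)
  hiddenRecursion = _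

  deriv-tail : ∀ m x c cs → U.deriv m (x ∷ c ∷ cs) ≡ R._*_ m (U.fromℕ m 1) c ∷ derivFrom m 2 cs
  deriv-tail m x c cs with c ∷ cs | 2
  ... | xs | k = cong (_ ∷_)
    (derivFrom-unique m (hiddenRecursion m) (λ _ _ _ → refl) (λ _ _ _ _ _ → refl) x xs k cs)

eval-coeff-derivFrom : ∀ m k cs i ρ →
  eval m (U.coeff m (derivFrom m k cs) i) ρ ≡ + (k ℕ.+ i) ℤ.* eval m (U.coeff m cs i) ρ
eval-coeff-derivFrom m k [] i ρ rewrite eval-0# m ρ = sym (ℤ.*-zeroʳ (+ (k ℕ.+ i)))
eval-coeff-derivFrom m k (c ∷ cs) zero ρ rewrite ℕ.+-identityʳ k =
  trans (eval-* m _ c ρ) (cong (ℤ._* eval m c ρ) (eval-fromℕ m k ρ))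
eval-coeff-derivFrom m k (c ∷ cs) (suc i) ρ rewrite ℕ.+-suc k i =
  eval-coeff-derivFrom m (suc k) cs i ρ

eval-coeff-deriv : ∀ m p i ρ →
  eval m (U.coeff m (U.deriv m p) i) ρ ≡ + suc i ℤ.* eval m (U.coeff m p (suc i)) ρ
eval-coeff-deriv m [] i ρ rewrite eval-0# m ρ = sym (ℤ.*-zeroʳ (+ suc i))
eval-coeff-deriv m (x ∷ []) i ρ rewrite eval-0# m ρ = sym (ℤ.*-zeroʳ (+ suc i))
eval-coeff-deriv m (x ∷ c ∷ cs) i ρ rewrite deriv-tail m x c cs =
  eval-coeff-derivFrom m 1 (c ∷ cs) i ρ

-- Integer determinants

Matrix : ℕ → Set
Matrix k = Fin k → Fin k → ℤ

detℤ : ∀ k → Matrix k → ℤ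
detℤ = U.det 0

altSumℤ : ∀ k → (Fin k → ℤ) → ℤ
altSumℤ = U.altSum 0

altSum-∣ : ∀ k {N} {f : Fin k → ℤ} → (∀ j → N ∣ f j) → N ∣ altSumℤ k f
altSum-∣ zero N∣f = ∣0
altSum-∣ (suc k) N∣f =
  ∣m∣n⇒∣m-n (N∣f Fin.zero) (altSum-∣ k (N∣f ∘ Fin.suc))

altSum-* : ∀ k L {f g : Fin k → ℤ} → (∀ j → f j ≡ L ℤ.* g j) → altSumℤ k f ≡ L ℤ.* altSumℤ k g
altSum-* zero L f≡Lg = sym (ℤ.*-zeroʳ L)
altSum-* (suc k) L {f} {g} f≡Lg = trans
  (cong₂ (λ u v → u ℤ.+ ℤ.- v) (f≡Lg Fin.zero) (altSum-* k L (f≡Lg ∘ Fin.suc)))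
  (rearrange L (g Fin.zero) _)
  where
  rearrange : ∀ L x y → L ℤ.* x ℤ.+ ℤ.- (L ℤ.* y) ≡ L ℤ.* (x ℤ.+ ℤ.- y)
  rearrange = solve-∀

det-cong : ∀ k {M M′ : Matrix k} → (∀ r c → M r c ≡ M′ r c) → detℤ k M ≡ detℤ k M′
det-cong zero M≡M′ = refl
det-cong (suc k) M≡M′ = altSum-cong (suc k) (λ j →
  cong₂ ℤ._*_ (M≡M′ Fin.zero j) (det-cong k (λ r c → M≡M′ (Fin.suc r) (punchIn j c))))

-- In the expansion along row zero, the entry at column zero carries `L` itself, and every other
-- minor keeps column zero, which yields `L` by induction.
det-scale-column₀ : ∀ k L (M M′ : Matrix (suc k)) →
  (∀ r → M r Fin.zero ≡ L ℤ.* M′ r Fin.zero) → (∀ r c → M r (Fin.suc c) ≡ M′ r (Fin.suc c)) →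
  detℤ (suc k) M ≡ L ℤ.* detℤ (suc k) M′
det-scale-column₀ k L M M′ col₀ rest = altSum-* (suc k) L
  {λ j → M Fin.zero j ℤ.* detℤ k (minor M j)} {λ j → M′ Fin.zero j ℤ.* detℤ k (minor M′ j)}
  (term k M M′ rest col₀)
  where
  term : ∀ k (M M′ : Matrix (suc k)) → (∀ r c → M r (Fin.suc c) ≡ M′ r (Fin.suc c)) →
    (∀ r → M r Fin.zero ≡ L ℤ.* M′ r Fin.zero) →
    ∀ j → M Fin.zero j ℤ.* detℤ k (minor M j) ≡ L ℤ.* (M′ Fin.zero j ℤ.* detℤ k (minor M′ j))
  term k M M′ rest col₀ Fin.zero = trans
    (cong₂ ℤ._*_ (col₀ Fin.zero) (det-cong k (λ r c → rest (Fin.suc r) c)))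
    (ℤ.*-assoc L _ _)
  term (suc k) M M′ rest col₀ (Fin.suc j) = trans
    (cong₂ ℤ._*_ (rest Fin.zero j)
      (det-scale-column₀ k L (minor M (Fin.suc j)) (minor M′ (Fin.suc j))
        (λ r → col₀ (Fin.suc r)) (λ r c → rest (Fin.suc r) (punchIn j c))))
    (rearrange (M′ Fin.zero (Fin.suc j)) L _)
    where
    rearrange : ∀ x L y → x ℤ.* (L ℤ.* y) ≡ L ℤ.* (x ℤ.* y)
    rearrange = solve-∀

column-∣-det : ∀ k {N} (M : Matrix k) c → (∀ r → N ∣ M r c) → N ∣ detℤ k M
column-∣-det (suc k) {N} M c N∣col = altSum-∣ (suc k) term
  where
  term : ∀ j → N ∣ M Fin.zero j ℤ.* detℤ k (minor M j)
  term j with j Fin.≟ c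
  ... | yes refl = ∣m⇒∣m*n _ (N∣col Fin.zero)
  -- Column `c` survives in this minor, at position `punchOut j≢c`.
  ... | no j≢c = ∣n⇒∣m*n (M Fin.zero j) (column-∣-det k (minor M j) (punchOut j≢c) (λ r →
    subst (λ c′ → N ∣ M (Fin.suc r) c′) (sym (Fin.punchIn-punchOut j≢c)) (N∣col (Fin.suc r))))

-- A nonzero product in the full expansion takes its entry of `c₂` from the last row, hence its
-- entry of `c₁` from another row, and each of the two gives a factor `t`. The induction expands
-- along row zero, which is not the last row once there are two distinct columns.
square-∣-det : ∀ k {t} (M : Matrix (suc k)) c₁ c₂ → c₁ ≢ c₂ →
  (∀ r → r ≢ fromℕ k → t ∣ M r c₁) → (∀ r → r ≢ fromℕ k → M r c₂ ≡ 0ℤ) → (∀ r → t ∣ M r c₂) →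
  t ℤ.* t ∣ detℤ (suc k) M
square-∣-det zero M Fin.zero Fin.zero c₁≢c₂ _ _ _ = ⊥-elim (c₁≢c₂ refl)
square-∣-det (suc k) {t} M c₁ c₂ c₁≢c₂ t∣col₁ col₂≡0 t∣col₂ = altSum-∣ (suc (suc k)) term
  where
  move : ∀ {j c} r (j≢c : j ≢ c) {Q : ℤ → Set} → Q (M (Fin.suc r) c) → Q (minor M j r (punchOut j≢c))
  move r j≢c {Q} = subst (λ c → Q (M (Fin.suc r) c)) (sym (Fin.punchIn-punchOut j≢c))

  term : ∀ j → t ℤ.* t ∣ M Fin.zero j ℤ.* detℤ (suc k) (minor M j)
  term j with j Fin.≟ c₁ | j Fin.≟ c₂
  ... | yes refl | yes refl = ⊥-elim (c₁≢c₂ refl)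
  ... | yes refl | no j≢c₂ = *-mono-∣ (t∣col₁ Fin.zero (λ ()))
    (column-∣-det (suc k) (minor M j) (punchOut j≢c₂) (λ r → move r j≢c₂ {t ∣_} (t∣col₂ (Fin.suc r))))
  ... | no _ | yes refl rewrite col₂≡0 Fin.zero (λ ()) = ∣0
  ... | no j≢c₁ | no j≢c₂ = ∣n⇒∣m*n (M Fin.zero j)
    (square-∣-det k (minor M j) (punchOut j≢c₁) (punchOut j≢c₂)
      (c₁≢c₂ ∘ Fin.punchOut-injective j≢c₁ j≢c₂)
      (λ r r≢ → move r j≢c₁ {t ∣_} (t∣col₁ (Fin.suc r) (r≢ ∘ Fin.suc-injective)))
      (λ r r≢ → move r j≢c₂ {_≡ 0ℤ} (col₂≡0 (Fin.suc r) (r≢ ∘ Fin.suc-injective)))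
      (λ r → move r j≢c₂ {t ∣_} (t∣col₂ (Fin.suc r))))

-- In the expansion along row zero, a minor for a later column keeps column zero of `M` from row one
-- on, which lies below the diagonal. So only the diagonal term survives modulo `N`.
det-unitriangular-mod : ∀ k {N} (M : Matrix k) →
  (∀ r c → toℕ c ℕ.< toℕ r → N ∣ M r c) → (∀ r → N ∣ M r r ℤ.- 1ℤ) → N ∣ detℤ k M ℤ.- 1ℤ
det-unitriangular-mod zero M below diag = ∣0
det-unitriangular-mod (suc k) {N} M below diag = subst (N ∣_)
  (rearrange (M Fin.zero Fin.zero) (detℤ k (minor M Fin.zero)) _)
  (∣m∣n⇒∣m-n
    (∣m∣n⇒∣m+n (∣m⇒∣m*n (detℤ k (minor M Fin.zero)) (diag Fin.zero))
      (det-unitriangular-mod k (minor M Fin.zero)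
        (λ r c c<r → below (Fin.suc r) (Fin.suc c) (s≤s c<r)) (diag ∘ Fin.suc)))
    (altSum-∣ k (tail k M below)))
  where
  rearrange : ∀ x d s → (x ℤ.- 1ℤ) ℤ.* d ℤ.+ (d ℤ.- 1ℤ) ℤ.- s ≡ x ℤ.* d ℤ.+ ℤ.- s ℤ.- 1ℤ
  rearrange = solve-∀

  tail : ∀ k (M : Matrix (suc k)) → (∀ r c → toℕ c ℕ.< toℕ r → N ∣ M r c) →
    ∀ j → N ∣ M Fin.zero (Fin.suc j) ℤ.* detℤ k (minor M (Fin.suc j))
  tail (suc k) M below j = ∣n⇒∣m*n (M Fin.zero (Fin.suc j))
    (column-∣-det (suc k) (minor M (Fin.suc j)) Fin.zero (λ r → below (Fin.suc r) Fin.zero (s≤s z≤n)))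

-- The Sylvester matrix of a polynomial and its derivative

rowℤ : (ℕ → ℤ) → ℕ → ℕ → ℕ → ℤ
rowℤ g m i c = if (i ≤ᵇ c) ∧ ((c ∸ i) ≤ᵇ m) then g (m ∸ (c ∸ i)) else 0ℤ

sylvesterℤ : ∀ d e → (f g : ℕ → ℤ) → Matrix (d ℕ.+ e)
sylvesterℤ d e f g r c =
  if toℕ r <ᵇ e then rowℤ f d (toℕ r) (toℕ c) else rowℤ g e (toℕ r ∸ e) (toℕ c)

sylvesterℤ-cong : ∀ d e {f f′ g g′} → (∀ i → f i ≡ f′ i) → (∀ i → g i ≡ g′ i) →
  ∀ r c → sylvesterℤ d e f g r c ≡ sylvesterℤ d e f′ g′ r c
sylvesterℤ-cong d e f≡f′ g≡g′ r c with toℕ r <ᵇ e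
... | true = cong (λ v → if _ then v else 0ℤ) (f≡f′ _)
... | false = cong (λ v → if _ then v else 0ℤ) (g≡g′ _)

T⇒≡true : ∀ {b} → T b → b ≡ true
T⇒≡true = Equivalence.to Bool.T-≡

≡true⇒T : ∀ {b} → b ≡ true → T b
≡true⇒T = Equivalence.from Bool.T-≡

rowℤ-entry : ∀ g i j k → rowℤ g (j ℕ.+ k) i (i ℕ.+ k) ≡ g j
rowℤ-entry g i j k
  rewrite T⇒≡true (ℕ.≤⇒≤ᵇ (ℕ.m≤m+n i k)) | ℕ.m+n∸m≡n i k
        | T⇒≡true (ℕ.≤⇒≤ᵇ (ℕ.m≤n+m k j)) | ℕ.m+n∸n≡m j k = refl

-- The index j is m − (c − i), described without truncated subtraction.
data RowView (g : ℕ → ℤ) (m i c : ℕ) : ℤ → Set where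
  outside : RowView g m i c 0ℤ
  inside  : ∀ j → i ℕ.≤ c → i ℕ.+ m ≡ c ℕ.+ j → RowView g m i c (g j)

rowView : ∀ g m i c → RowView g m i c (rowℤ g m i c)
rowView g m i c with i ≤ᵇ c in i≤ᵇc | (c ∸ i) ≤ᵇ m in c∸i≤ᵇm
... | false | _ = outside
... | true | false = outside
... | true | true = inside (m ∸ (c ∸ i)) i≤c (begin
  i ℕ.+ m                                     ≡⟨ cong (i ℕ.+_) (ℕ.m+[n∸m]≡n c∸i≤m) ⟨
  i ℕ.+ ((c ∸ i) ℕ.+ (m ∸ (c ∸ i)))           ≡⟨ ℕ.+-assoc i _ _ ⟨
  i ℕ.+ (c ∸ i) ℕ.+ (m ∸ (c ∸ i))             ≡⟨ cong (ℕ._+ (m ∸ (c ∸ i))) (ℕ.m+[n∸m]≡n i≤c) ⟩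
  c ℕ.+ (m ∸ (c ∸ i)) ∎)
  where
  i≤c : i ℕ.≤ c
  i≤c = ℕ.≤ᵇ⇒≤ i c (≡true⇒T i≤ᵇc)
  c∸i≤m : c ∸ i ℕ.≤ m
  c∸i≤m = ℕ.≤ᵇ⇒≤ _ m (≡true⇒T c∸i≤ᵇm)

-- The equation for `x` is stored next to the view so that the exact entry can be recovered, as on
-- the diagonal, after `x` has been abstracted.
data SylvesterView (d e : ℕ) (f g : ℕ → ℤ) (r c : ℕ) : ℤ → Set where
  upper : ∀ {x} → r ℕ.< e → x ≡ rowℤ f d r c → RowView f d r c x → SylvesterView d e f g r c x
  lower : ∀ {x} i → r ≡ e ℕ.+ i → x ≡ rowℤ g e i c → RowView g e i c x → SylvesterView d e f g r c x

sylvesterView : ∀ d e f g r c → SylvesterView d e f g (toℕ r) (toℕ c) (sylvesterℤ d e f g r c)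
sylvesterView d e f g r c with toℕ r <ᵇ e in r<ᵇe
... | true = upper (ℕ.<ᵇ⇒< _ e (≡true⇒T r<ᵇe)) refl (rowView f d _ _)
... | false = lower (toℕ r ∸ e) (sym (ℕ.m+[n∸m]≡n (ℕ.≮⇒≥ r≮e))) refl (rowView g e _ _)
  where
  r≮e : toℕ r ℕ.≮ e
  r≮e r<e with () ← trans (sym r<ᵇe) (T⇒≡true (ℕ.<⇒<ᵇ r<e))

derivℤ : (ℕ → ℤ) → ℕ → ℤ
derivℤ f i = + suc i ℤ.* f (suc i)

-- Here `f` has formal degree `suc d`: the first `d` rows come from `f`, the other `suc d` rows from
-- its derivative.
discMatrix : ∀ d → (ℕ → ℤ) → Matrix (suc (d ℕ.+ d))
discMatrix d f = sylvesterℤ (suc d) d f (derivℤ f)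

-- Opaque, since otherwise every with-abstraction expands the determinant.
opaque
  derivResultant : ℕ → (ℕ → ℤ) → ℤ
  derivResultant d f = detℤ (suc (d ℕ.+ d)) (discMatrix d f)

  derivResultant-det : ∀ d f → derivResultant d f ≡ detℤ (suc (d ℕ.+ d)) (discMatrix d f)
  derivResultant-det d f = refl

-- Think of a row with shift `x` of a polynomial of degree `u`: column `v` holds the coefficient of
-- index `j` where `x + u = v + j`. The index grows with the shift, so the largest admissible shift
-- `y` bounds it by `b`.
index-≤ : ∀ v j b {x y u} → x ℕ.≤ y → x ℕ.+ u ≡ v ℕ.+ j → y ℕ.+ u ≡ v ℕ.+ b → j ℕ.≤ b
index-≤ v j b {u = u} x≤y p q =
  ℕ.+-cancelˡ-≤ v j b (subst₂ ℕ._≤_ p q (ℕ.+-monoˡ-≤ u x≤y))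

lower-index-≤ : ∀ d i {r} → r ≡ d ℕ.+ i → r ℕ.≤ d ℕ.+ d → i ℕ.≤ d
lower-index-≤ d i refl = ℕ.+-cancelˡ-≤ d i d

-- The last column meets only constant terms: `f 0` in the last row coming from `f`, and
-- `derivℤ f 0`, which is `f 1`, in the last row of the derivative.
discMatrix-last-column : ∀ d f {N} → N ∣ f 0 → N ∣ f 1 → ∀ r → N ∣ discMatrix d f r (fromℕ (d ℕ.+ d))
discMatrix-last-column d f {N} N∣f₀ N∣f₁ r
  with discMatrix d f r (fromℕ (d ℕ.+ d)) | sylvesterView (suc d) d f (derivℤ f) r (fromℕ (d ℕ.+ d))
... | _ | upper _ _ outside = ∣0
... | _ | lower _ _ _ outside = ∣0
... | _ | upper r<d _ (inside j _ eq) rewrite Fin.toℕ-fromℕ (d ℕ.+ d)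
  with z≤n ← index-≤ (d ℕ.+ d) j 0 r<d (trans (sym (ℕ.+-suc _ d)) eq) (sym (ℕ.+-identityʳ _)) = N∣f₀
... | _ | lower i r≡ _ (inside j _ eq) rewrite Fin.toℕ-fromℕ (d ℕ.+ d)
  with z≤n ← index-≤ (d ℕ.+ d) j 0 (lower-index-≤ d i r≡ (Fin.toℕ≤pred[n] r)) eq (sym (ℕ.+-identityʳ _)) =
    ∣n⇒∣m*n 1ℤ N∣f₁

-- The first column consists of multiples of the leading coefficient. Dividing it out gives `M′`,
-- whose last column is still divisible by `N`.
derivResultant-leading-factor : ∀ d f {N} → N ∣ f 0 → N ∣ f 1 →
  ∃ λ x → N ∣ x × derivResultant (suc d) f ≡ f (suc (suc d)) ℤ.* x
derivResultant-leading-factor e f {N} N∣f₀ N∣f₁ =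
  detℤ (suc k) M′ ,
  -- As `k` is a successor, the last column is not column zero, so `M′` agrees with `M` there.
  column-∣-det (suc k) M′ (fromℕ k) (discMatrix-last-column d f N∣f₀ N∣f₁) ,
  trans (derivResultant-det d f) (det-scale-column₀ k (f (suc d)) M M′
    (λ r → trans (_∣_.equality (column₀ r)) (ℤ.*-comm _ (f (suc d)))) (λ _ _ → refl))
  where
  d = suc e
  k = d ℕ.+ d
  M = discMatrix d f

  column₀ : ∀ r → f (suc d) ∣ M r Fin.zero
  column₀ r with M r Fin.zero | sylvesterView (suc d) d f (derivℤ f) r Fin.zero
  ... | _ | upper _ _ outside = ∣0
  ... | _ | lower _ _ _ outside = ∣0
  ... | _ | upper _ _ (inside j r≤0 eq)
    with refl ← trans (cong (ℕ._+ suc d) (sym (ℕ.n≤0⇒n≡0 r≤0))) eq = ∣-refl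
  ... | _ | lower i _ _ (inside j z≤n refl) = ∣n⇒∣m*n (+ suc d) ∣-refl

  M′ : Matrix (suc k)
  M′ r Fin.zero = quotient (column₀ r)
  M′ r (Fin.suc c) = M r (Fin.suc c)

-- With `f 0` zero, the last column is zero except for `f 1` in the last row, and the column before
-- it has only multiples of `f 1` above the last row. Its entry `2 * f 2` sits in the last row,
-- which `square-∣-det` leaves free.
square-∣-derivResultant : ∀ d f → f 0 ≡ 0ℤ → f 1 ℤ.* f 1 ∣ derivResultant (suc d) f
square-∣-derivResultant e f f₀≡0 = subst (f 1 ℤ.* f 1 ∣_) (sym (derivResultant-det d f))
  (square-∣-det k M c₁ c₂ c₁≢c₂ column₁ column₂
  (discMatrix-last-column d f (subst (f 1 ∣_) (sym f₀≡0) ∣0) ∣-refl))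
  where
  d = suc e
  k = d ℕ.+ d
  M = discMatrix d f
  -- The column next to the last, since `k` is `suc (e + d)`.
  c₁ = inject₁ (fromℕ (e ℕ.+ d))
  c₂ = fromℕ k

  toℕ-c₁ : toℕ c₁ ≡ e ℕ.+ d
  toℕ-c₁ = trans (Fin.toℕ-inject₁ _) (Fin.toℕ-fromℕ (e ℕ.+ d))

  c₁≢c₂ : c₁ ≢ c₂
  c₁≢c₂ c₁≡c₂ = ℕ.1+n≢n (trans (sym (Fin.toℕ-fromℕ k)) (trans (cong toℕ (sym c₁≡c₂)) toℕ-c₁))

  not-last : ∀ {r : Fin (suc k)} → r ≢ c₂ → toℕ r ℕ.≤ d ℕ.+ e
  not-last {r} r≢c₂ = ℕ.≤-pred (subst (toℕ r ℕ.<_) (ℕ.+-suc d e)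
    (ℕ.≤∧≢⇒< (Fin.toℕ≤pred[n] r) (λ r≡k → r≢c₂ (Fin.toℕ-injective (trans r≡k (sym (Fin.toℕ-fromℕ k)))))))

  column₁ : ∀ r → r ≢ c₂ → f 1 ∣ M r c₁
  column₁ r r≢c₂ with M r c₁ | sylvesterView (suc d) d f (derivℤ f) r c₁
  ... | _ | upper _ _ outside = ∣0
  ... | _ | lower _ _ _ outside = ∣0
  ... | _ | upper (s≤s r≤e) _ (inside j _ eq) rewrite toℕ-c₁
    with index-≤ (e ℕ.+ d) j 1 r≤e eq (trans (ℕ.+-suc e d) (ℕ.+-comm 1 _))
  ...   | z≤n = subst (f 1 ∣_) (sym f₀≡0) ∣0
  ...   | s≤s z≤n = ∣-refl
  column₁ r r≢c₂ | _ | lower i r≡ _ (inside j _ eq) rewrite toℕ-c₁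
    with z≤n ← index-≤ (e ℕ.+ d) j 0 (ℕ.+-cancelˡ-≤ d i e (subst (ℕ._≤ d ℕ.+ e) r≡ (not-last r≢c₂)))
                 eq (sym (ℕ.+-identityʳ _)) = ∣n⇒∣m*n 1ℤ ∣-refl

  column₂ : ∀ r → r ≢ c₂ → M r c₂ ≡ 0ℤ
  column₂ r r≢c₂ with M r c₂ | sylvesterView (suc d) d f (derivℤ f) r c₂
  ... | _ | upper _ _ outside = refl
  ... | _ | lower _ _ _ outside = refl
  ... | _ | upper (s≤s r≤e) _ (inside j _ eq) rewrite Fin.toℕ-fromℕ (e ℕ.+ d)
    with z≤n ← index-≤ k j 0 r≤e eq (trans (ℕ.+-suc e d) (sym (ℕ.+-identityʳ _))) = f₀≡0
  -- A derivative row other than the last has shift at most `e` and ends before the last column.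
  ... | _ | lower i r≡ _ (inside j _ eq) rewrite Fin.toℕ-fromℕ (e ℕ.+ d)
    with () ← index-≤ (e ℕ.+ d) (suc j) 0 (ℕ.+-cancelˡ-≤ d i e (subst (ℕ._≤ d ℕ.+ e) r≡ (not-last r≢c₂)))
                 (trans eq (sym (ℕ.+-suc _ j))) (sym (ℕ.+-identityʳ _))

-- A row of `f` starts on the diagonal with the leading coefficient. A row of the derivative has its
-- constant term `f 1` on the diagonal and its higher coefficients, divisible by `suc d`, to the
-- left of it.
derivResultant-mod-degree : ∀ d f → f 1 ≡ 1ℤ → f (suc d) ≡ 1ℤ → (∀ j → + suc d ∣ derivℤ f (suc j)) →
  + suc d ∣ derivResultant d f ℤ.- 1ℤ
derivResultant-mod-degree d f f₁≡1 f-top≡1 ∣f′ =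
  subst (λ x → + suc d ∣ x ℤ.- 1ℤ) (sym (derivResultant-det d f))
    (det-unitriangular-mod (suc (d ℕ.+ d)) (discMatrix d f) below diagonal)
  where
  below : ∀ r c → toℕ c ℕ.< toℕ r → + suc d ∣ discMatrix d f r c
  below r c c<r with discMatrix d f r c | sylvesterView (suc d) d f (derivℤ f) r c
  ... | _ | upper _ _ outside = ∣0
  ... | _ | lower _ _ _ outside = ∣0
  ... | _ | upper _ _ (inside j r≤c eq) = ⊥-elim (ℕ.<⇒≱ c<r r≤c)
  ... | _ | lower i r≡ _ (inside (suc j) _ eq) = ∣f′ j
  ... | _ | lower i r≡ _ (inside zero _ eq) = ⊥-elim (ℕ.<-irrefl
    (trans (sym (ℕ.+-identityʳ _)) (trans (sym eq) (trans (ℕ.+-comm i d) (sym r≡)))) c<r)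

  ≡1⇒∣-1 : ∀ {x} → x ≡ 1ℤ → + suc d ∣ x ℤ.- 1ℤ
  ≡1⇒∣-1 refl = ∣0

  diagonal : ∀ r → + suc d ∣ discMatrix d f r r ℤ.- 1ℤ
  diagonal r with discMatrix d f r r | sylvesterView (suc d) d f (derivℤ f) r r
  ... | _ | upper _ x≡ _ = ≡1⇒∣-1 (trans x≡ (trans
    (subst₂ (λ m c → rowℤ f m (toℕ r) c ≡ f (suc d)) (ℕ.+-identityʳ (suc d)) (ℕ.+-identityʳ (toℕ r))
      (rowℤ-entry f (toℕ r) (suc d) 0)) f-top≡1))
  ... | _ | lower i r≡ x≡ _ = ≡1⇒∣-1 (trans x≡ (trans
    (subst (λ c → rowℤ (derivℤ f) d i c ≡ derivℤ f 0) (trans (ℕ.+-comm i d) (sym r≡))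
      (rowℤ-entry (derivℤ f) i 0 d)) (trans (ℤ.*-identityˡ (f 1)) f₁≡1)))

-- Vanishing and degrees

infixr 5 _▸_
_▸_ : ℤ → (ℕ → ℤ) → ℕ → ℤ
(t ▸ σ) zero = t
(t ▸ σ) (suc i) = σ i

_≡_[mod_] : (ℕ → ℤ) → (ℕ → ℤ) → ℤ → Set
ρ ≡ σ [mod N ] = ∀ i → N ∣ ρ i ℤ.- σ i

eval-mod : ∀ m p ρ σ {N} → ρ ≡ σ [mod N ] → N ∣ eval m p ρ ℤ.- eval m p σ
eval-mod zero p ρ σ _ = ∣-self p
eval-mod (suc m) [] ρ σ _ = ∣0
eval-mod (suc m) (x ∷ p) ρ σ {N} ρ≡σ = subst (N ∣_)
  (rearrange (eval m x _) (eval m x _) (ρ 0) (σ 0) (eval (suc m) p ρ) (eval (suc m) p σ))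
  (∣m∣n⇒∣m+n (eval-mod m x (ρ ∘ suc) (σ ∘ suc) (λ i → ρ≡σ (suc i)))
    (∣m∣n⇒∣m+n (∣n⇒∣m*n (ρ 0) (eval-mod (suc m) p ρ σ ρ≡σ)) (∣m⇒∣m*n (eval (suc m) p σ) (ρ≡σ 0))))
  where
  rearrange : ∀ x y t s p q →
    (x ℤ.- y) ℤ.+ (t ℤ.* (p ℤ.- q) ℤ.+ (t ℤ.- s) ℤ.* q) ≡ (x ℤ.+ t ℤ.* p) ℤ.- (y ℤ.+ s ℤ.* q)
  rearrange = solve-∀

isZero-sound : ∀ m p → R.isZero m p ≡ true → ∀ ρ → eval m p ρ ≡ 0ℤ
isZero-sound zero (+ zero) _ ρ = refl
isZero-sound (suc m) [] _ ρ = refl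
isZero-sound (suc m) (x ∷ p) z ρ =
  trans (cong₂ (λ u v → u ℤ.+ ρ 0 ℤ.* v)
      (isZero-sound m x (Bool.∧-conicalˡ _ _ z) _)
      (isZero-sound (suc m) p (Bool.∧-conicalʳ (R.isZero m x) _ z) ρ))
    (trans (ℤ.+-identityˡ _) (ℤ.*-zeroʳ (ρ 0)))

-- The shift by `suc b * suc k` is taken with the sign of `a`, so it moves away from zero and alone
-- already exceeds `b`.
large-congruent : ∀ k a b → ∃ λ t → + suc k ∣ t ℤ.- a × b ℕ.< ℤ.∣ t ∣
large-congruent k (+ a) b =
  + (suc b ℕ.* suc k ℕ.+ a) ,
  divides (+ suc b) (trans (cong (ℤ._- + a) (ℤ.pos-+ (suc b ℕ.* suc k) a))
    (trans (cancel (+ (suc b ℕ.* suc k)) (+ a)) (ℤ.pos-* (suc b) (suc k)))) ,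
  ℕ.≤-trans (ℕ.m≤m*n (suc b) (suc k)) (ℕ.m≤m+n _ a)
  where
  cancel : ∀ x y → x ℤ.+ y ℤ.- y ≡ x
  cancel = solve-∀
large-congruent k -[1+ a ] b =
  ℤ.- + (suc b ℕ.* suc k ℕ.+ suc a) ,
  divides (ℤ.- + suc b) (trans (cong (λ v → ℤ.- v ℤ.- -[1+ a ]) (ℤ.pos-+ (suc b ℕ.* suc k) (suc a)))
    (trans (cancel (+ (suc b ℕ.* suc k)) (+ suc a))
      (trans (cong ℤ.-_ (ℤ.pos-* (suc b) (suc k))) (ℤ.neg-distribˡ-* (+ suc b) (+ suc k))))) ,
  subst (b ℕ.<_) (sym (ℤ.∣-i∣≡∣i∣ (+ (suc b ℕ.* suc k ℕ.+ suc a))))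
    (ℕ.≤-trans (ℕ.m≤m*n (suc b) (suc k)) (ℕ.m≤m+n _ (suc a)))
  where
  cancel : ∀ x y → ℤ.- (x ℤ.+ y) ℤ.- (ℤ.- y) ≡ ℤ.- x
  cancel = solve-∀

nonvanishing : ∀ m p → R.isZero m p ≡ false → ∀ k ρ →
  ∃ λ σ → (σ ≡ ρ [mod + suc k ]) × eval m p σ ≢ 0ℤ

-- A nonzero first coefficient x cannot be cancelled at a value t of the outer
-- variable with ∣x∣ < ∣t∣.
nonvanishing-list : ∀ m p → U.isZeroL m p ≡ false → ∀ k ρ →
  ∃ λ σ → (σ ≡ ρ [mod + suc k ]) × σ 0 ≢ 0ℤ × eval (suc m) p σ ≢ 0ℤ
nonvanishing-list m (x ∷ p) nz k ρ with R.isZero m x in x≟0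
-- The value is now `σ 0` times that of the tail, which is why `σ 0 ≢ 0ℤ` is carried through the
-- induction.
... | true with σ , σ≡ρ , σ₀≢0 , pσ≢0 ← nonvanishing-list m p nz k ρ =
  σ , σ≡ρ , σ₀≢0 , λ eq → [ σ₀≢0 , pσ≢0 ]′ (ℤ.i*j≡0⇒i≡0∨j≡0 (σ 0) (trans (sym (ℤ.+-identityˡ _))
    (trans (cong (ℤ._+ σ 0 ℤ.* eval (suc m) p σ) (sym (isZero-sound m x x≟0 _))) eq)))
... | false
  with σ , σ≡ρ , xσ≢0 ← nonvanishing m x x≟0 k (ρ ∘ suc)
  with t , t≡ρ₀ , big ← large-congruent k (ρ 0) ℤ.∣ eval m x σ ∣ =
  t ▸ σ , (λ { zero → t≡ρ₀ ; (suc i) → σ≡ρ i }) ,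
  (λ { refl → ℕ.n≮0 big }) ,
  λ eq → ℕ.<⇒≱ big (∣ℕ⇒≤ {{ℕ.≢-nonZero (xσ≢0 ∘ ℤ.∣i∣≡0⇒i≡0)}} (∣⇒∣ᵤ
    (∣m+n∣n⇒∣m {m = eval m x σ} (subst (t ∣_) (sym eq) ∣0) (∣m⇒∣m*n (eval (suc m) p (t ▸ σ)) ∣-refl))))

nonvanishing zero (+ suc n) _ k ρ = ρ , (λ i → ∣-self (ρ i)) , λ ()
nonvanishing zero -[1+ n ] _ k ρ = ρ , (λ i → ∣-self (ρ i)) , λ ()
nonvanishing (suc m) p nz k ρ with σ , σ≡ρ , _ , pσ≢0 ← nonvanishing-list m p nz k ρ = σ , σ≡ρ , pσ≢0

isZero-complete : ∀ m p → (∀ ρ → eval m p ρ ≡ 0ℤ) → R.isZero m p ≡ true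
isZero-complete m p p≡0 with R.isZero m p in p≟0
... | true = refl
... | false with σ , _ , pσ≢0 ← nonvanishing m p p≟0 0 (λ _ → 0ℤ) = ⊥-elim (pσ≢0 (p≡0 σ))

isZero-false : ∀ m p ρ → eval m p ρ ≢ 0ℤ → R.isZero m p ≡ false
isZero-false m p ρ pρ≢0 with R.isZero m p in p≟0
... | true = ⊥-elim (pρ≢0 (isZero-sound m p p≟0 ρ))
... | false = refl

eval-strip : ∀ m p ρ → eval (suc m) (U.strip m p) ρ ≡ eval (suc m) p ρ
eval-strip m [] ρ = refl
eval-strip m (x ∷ p) ρ with U.strip m p | eval-strip m p ρ
... | _ ∷ _ | ih = cong (λ v → eval m x _ ℤ.+ ρ 0 ℤ.* v) ih
... | [] | ih with R.isZero m x in x≟0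
...   | false = cong (λ v → eval m x _ ℤ.+ ρ 0 ℤ.* v) ih
...   | true = trans (sym (trans (ℤ.+-identityˡ _) (ℤ.*-zeroʳ (ρ 0))))
                 (cong₂ (λ u v → u ℤ.+ ρ 0 ℤ.* v) (sym (isZero-sound m x x≟0 _)) ih)

eval-coeff-strip : ∀ m p i ρ → eval m (U.coeff m (U.strip m p) i) ρ ≡ eval m (U.coeff m p i) ρ
eval-coeff-strip m [] i ρ = refl
eval-coeff-strip m (x ∷ p) i ρ with U.strip m p | (λ i → eval-coeff-strip m p i ρ)
eval-coeff-strip m (x ∷ p) zero ρ | _ ∷ _ | ih = refl
eval-coeff-strip m (x ∷ p) (suc i) ρ | _ ∷ _ | ih = ih i
eval-coeff-strip m (x ∷ p) i ρ | [] | ih with R.isZero m x in x≟0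
eval-coeff-strip m (x ∷ p) zero ρ | [] | ih | true =
  trans (eval-0# m ρ) (sym (isZero-sound m x x≟0 ρ))
eval-coeff-strip m (x ∷ p) (suc i) ρ | [] | ih | true = ih i
eval-coeff-strip m (x ∷ p) zero ρ | [] | ih | false = refl
eval-coeff-strip m (x ∷ p) (suc i) ρ | [] | ih | false = ih i

strip-≡[] : ∀ m p → (∀ i ρ → eval m (U.coeff m p i) ρ ≡ 0ℤ) → U.strip m p ≡ []
strip-≡[] m [] _ = refl
strip-≡[] m (x ∷ p) vanish
  rewrite strip-≡[] m p (vanish ∘ suc) | isZero-complete m x (vanish 0) = refl

length-strip : ∀ m p d ρ → eval m (U.coeff m p d) ρ ≢ 0ℤ →
  (∀ i → d ℕ.< i → ∀ σ → eval m (U.coeff m p i) σ ≡ 0ℤ) → length (U.strip m p) ≡ suc d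
length-strip m [] d ρ pd≢0 _ = ⊥-elim (pd≢0 (eval-0# m ρ))
length-strip m (x ∷ p) zero ρ x≢0 vanish
  rewrite strip-≡[] m p (λ i → vanish (suc i) (s≤s z≤n)) | isZero-false m x ρ x≢0 = refl
length-strip m (x ∷ p) (suc d) ρ pd≢0 vanish
  with U.strip m p | length-strip m p d ρ pd≢0 (λ i d<i → vanish (suc i) (s≤s d<i))
... | _ ∷ _ | ih = cong suc ih

degree-≡ : ∀ m p d ρ → eval m (U.coeff m p d) ρ ≢ 0ℤ →
  (∀ i → d ℕ.< i → ∀ σ → eval m (U.coeff m p i) σ ≡ 0ℤ) → U.degree m p ≡ d
degree-≡ m p d ρ pd≢0 vanish = cong (_∸ 1) (length-strip m p d ρ pd≢0 vanish)

isZero-last-strip : ∀ m p l → length (U.strip m p) ≡ suc l → R.isZero m (U.coeff m (U.strip m p) l) ≡ false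
isZero-last-strip m (x ∷ p) l len with U.strip m p | isZero-last-strip m p
isZero-last-strip m (x ∷ p) (suc l) len | _ ∷ _ | ih = ih l (ℕ.suc-injective len)
isZero-last-strip m (x ∷ p) l len | [] | ih with R.isZero m x in x≟0
isZero-last-strip m (x ∷ p) zero len | [] | ih | false = x≟0

coeff-beyond : ∀ m cs i → length cs ℕ.≤ i → U.coeff m cs i ≡ R.0# m
coeff-beyond m [] i _ = refl
coeff-beyond m (_ ∷ cs) (suc i) (s≤s l≤i) = coeff-beyond m cs i l≤i

length-strip-degree : ∀ m p d → U.degree m p ≡ suc d → length (U.strip m p) ≡ suc (suc d)
length-strip-degree m p d deg with U.strip m p
length-strip-degree m p d refl | _ ∷ _ ∷ _ = refl

eval-coeff-beyond-degree : ∀ m p d → U.degree m p ≡ suc d →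
  ∀ i → suc d ℕ.< i → ∀ ρ → eval m (U.coeff m p i) ρ ≡ 0ℤ
eval-coeff-beyond-degree m p d deg i d<i ρ = trans (sym (eval-coeff-strip m p i ρ))
  (trans (cong (λ c → eval m c ρ) (coeff-beyond m (U.strip m p) i
    (subst (ℕ._≤ i) (sym (length-strip-degree m p d deg)) d<i))) (eval-0# m ρ))

leading-nonvanishing : ∀ m p d → U.degree m p ≡ suc d → ∀ k ρ →
  ∃ λ σ → (σ ≡ ρ [mod + suc k ]) × eval m (U.coeff m p (suc d)) σ ≢ 0ℤ
leading-nonvanishing m p d deg k ρ
  with σ , σ≡ρ , nz ← nonvanishing m _
         (isZero-last-strip m p (suc d) (length-strip-degree m p d deg)) k ρ =
  σ , σ≡ρ , nz ∘ trans (eval-coeff-strip m p (suc d) σ)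

-- In characteristic zero the factor `+ suc d` does not kill the leading coefficient.
degree-deriv : ∀ m p d → U.degree m p ≡ suc d → U.degree m (U.deriv m p) ≡ d
degree-deriv m p d deg with σ , _ , nz ← leading-nonvanishing m p d deg 0 (λ _ → 0ℤ) =
  degree-≡ m (U.deriv m p) d σ
    (λ eq → nz (ℤ.*-cancelˡ-≡ (+ suc d) _ _
      (trans (trans (sym (eval-coeff-deriv m p d σ)) eq) (sym (ℤ.*-zeroʳ (+ suc d))))))
    (λ i d<i ρ → trans (eval-coeff-deriv m p i ρ)
      (trans (cong (+ suc i ℤ.*_) (eval-coeff-beyond-degree m p d deg (suc i) (s≤s d<i) ρ)) (ℤ.*-zeroʳ (+ suc i))))

coeffs : ∀ m → P (suc m) → (ℕ → ℤ) → ℕ → ℤ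
coeffs m p ρ i = eval m (U.coeff m p i) ρ

-- The matrix size comes from the degrees before evaluation, so evaluation commutes with the
-- resultant even at points `ρ` where a leading coefficient vanishes.
eval-resultant : ∀ m p q {d e} → U.degree m p ≡ d → U.degree m q ≡ e → ∀ ρ →
  eval m (U.resultant m p q) ρ ≡ detℤ (d ℕ.+ e) (sylvesterℤ d e (coeffs m p ρ) (coeffs m q ρ))
eval-resultant m p q refl refl ρ = trans
  (eval-det m _ (U.sylvester m p q) ρ) (det-cong (U.degree m p ℕ.+ U.degree m q) entry)
  where
  eval-guarded-coeff : ∀ b s j → eval m (if b then U.coeff m (U.strip m s) j else R.0# m) ρ ≡
    (if b then coeffs m s ρ j else 0ℤ)
  eval-guarded-coeff true s j = eval-coeff-strip m s j ρ
  eval-guarded-coeff false s j = eval-0# m ρ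

  entry : ∀ r c → eval m (U.sylvester m p q r c) ρ ≡
    sylvesterℤ (U.degree m p) (U.degree m q) (coeffs m p ρ) (coeffs m q ρ) r c
  entry r c with toℕ r <ᵇ U.degree m q
  ... | true = eval-guarded-coeff _ p _
  ... | false = eval-guarded-coeff _ q _

-- Discriminants

eval-signDisc≢0 : ∀ m d ρ → eval m (U.signDisc m d) ρ ≢ 0ℤ
eval-signDisc≢0 m zero ρ eq with () ← trans (sym (eval-1# m ρ)) eq
eval-signDisc≢0 m (suc d) ρ with evenᵇ d
... | true = eval-signDisc≢0 m d ρ
... | false = λ eq → eval-signDisc≢0 m d ρ
  (ℤ.neg-injective (trans (sym (eval-neg m (U.signDisc m d) ρ)) eq))

-- The defining equation of the discriminant at an integer point; `s` is the sign in front of the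
-- resultant.
IsDisc⇒derivResultant : ∀ m g D d → U.degree m g ≡ suc d → IsDisc m g D → ∀ ρ →
  ∃ λ s → s ≢ 0ℤ × coeffs m g ρ (suc d) ℤ.* eval m D ρ ≡
                   s ℤ.* derivResultant d (coeffs m g ρ)
IsDisc⇒derivResultant m g D d deg isDisc ρ =
  eval m (U.signDisc m (U.degree m g)) ρ , eval-signDisc≢0 m (U.degree m g) ρ , (begin
  coeffs m g ρ (suc d) ℤ.* eval m D ρ
    ≡⟨ cong (ℤ._* eval m D ρ) (trans (cong (coeffs m g ρ) (sym deg)) (sym (eval-coeff-strip m g _ ρ))) ⟩
  eval m (U.lc m g) ρ ℤ.* eval m D ρ
    ≡⟨ eval-* m (U.lc m g) D ρ ⟨
  eval m (R._*_ m (U.lc m g) D) ρ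
    ≡⟨ isDisc ρ ⟩
  eval m (R._*_ m (U.signDisc m (U.degree m g)) (U.resultant m g (U.deriv m g))) ρ
    ≡⟨ eval-* m (U.signDisc m (U.degree m g)) (U.resultant m g (U.deriv m g)) ρ ⟩
  eval m (U.signDisc m (U.degree m g)) ρ ℤ.* eval m (U.resultant m g (U.deriv m g)) ρ
    ≡⟨ cong (eval m (U.signDisc m (U.degree m g)) ρ ℤ.*_) (trans
         (eval-resultant m g (U.deriv m g) deg (degree-deriv m g d deg) ρ)
         (trans (det-cong (suc (d ℕ.+ d)) (sylvesterℤ-cong (suc d) d {coeffs m g ρ}
           (λ _ → refl) (λ i → eval-coeff-deriv m g i ρ)))
           (sym (derivResultant-det d (coeffs m g ρ))))) ⟩
  eval m (U.signDisc m (U.degree m g)) ρ ℤ.* derivResultant d (coeffs m g ρ) ∎)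

update : (ℕ → ℤ) → ℕ → ℤ → ℕ → ℤ
update σ zero x = x ▸ σ ∘ suc
update σ (suc j) x = σ 0 ▸ update (σ ∘ suc) j x

update-at : ∀ σ j x → update σ j x j ≡ x
update-at σ zero x = refl
update-at σ (suc j) x = update-at (σ ∘ suc) j x

update-other : ∀ σ j x i → i ≢ j → update σ j x i ≡ σ i
update-other σ zero x zero i≢j = ⊥-elim (i≢j refl)
update-other σ zero x (suc i) i≢j = refl
update-other σ (suc j) x zero i≢j = refl
update-other σ (suc j) x (suc i) i≢j = update-other (σ ∘ suc) j x i (i≢j ∘ cong suc)

update-mod : ∀ σ j {x N} → N ∣ x ℤ.- σ j → update σ j x ≡ σ [mod N ]
update-mod σ zero N∣ zero = N∣
update-mod σ zero N∣ (suc i) = ∣-self (σ (suc i))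
update-mod σ (suc j) N∣ zero = ∣-self (σ 0)
update-mod σ (suc j) N∣ (suc i) = update-mod (σ ∘ suc) j N∣ i

-- If coordinate `suc j` is zero, it is replaced by `+ suc k`, which is congruent to it modulo
-- `+ suc k` and leaves `σ 0` unchanged. The value at `σ` is thus divisible by every positive
-- integer.
vanishes-off-hyperplane : ∀ m p j →
  (∀ σ → σ 0 ≡ 0ℤ → σ (suc j) ≢ 0ℤ → eval m p σ ≡ 0ℤ) → ∀ σ → σ 0 ≡ 0ℤ → eval m p σ ≡ 0ℤ
vanishes-off-hyperplane m p j vanish σ σ₀≡0 with σ (suc j) ℤ.≟ 0ℤ
... | no σⱼ≢0 = vanish σ σ₀≡0 σⱼ≢0
... | yes σⱼ≡0 = ∣-by-all⇒≡0 (λ k →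
  let σ′ = update σ (suc j) (+ suc k)
      σ′ⱼ≢0 = λ eq → +suc≢0 (trans (sym (update-at σ (suc j) (+ suc k))) eq)
  in ∣-difference⇒∣ (eval-mod m p σ′ σ (update-mod σ (suc j)
         (∣m∣n⇒∣m-n ∣-refl (subst (+ suc k ∣_) (sym σⱼ≡0) ∣0))))
       (subst (+ suc k ∣_) (sym (vanish σ′ σ₀≡0 σ′ⱼ≢0)) ∣0))

eval-var : ∀ m i ρ → i ℕ.< m → eval m (var m i) ρ ≡ ρ i
eval-var (suc m) zero ρ _ = trans
  (cong₂ (λ u v → u ℤ.+ ρ 0 ℤ.* (v ℤ.+ ρ 0 ℤ.* 0ℤ)) (eval-0# m _) (eval-1# m _)) (simplify (ρ 0))
  where
  simplify : ∀ t → 0ℤ ℤ.+ t ℤ.* (1ℤ ℤ.+ t ℤ.* 0ℤ) ≡ t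
  simplify = solve-∀
eval-var (suc m) (suc i) ρ (s≤s i<m) = trans
  (cong₂ ℤ._+_ (eval-var m i (ρ ∘ suc) i<m) (ℤ.*-zeroʳ (ρ 0))) (ℤ.+-identityʳ _)

-- Where the outer variable is zero only the constant coefficient `c` is left. So `c` vanishes and
-- the tail `cs` is the quotient.
Divides-var₀ : ∀ m b → (∀ ρ → ρ 0 ≡ 0ℤ → eval (suc m) b ρ ≡ 0ℤ) → Divides (suc m) (var (suc m) 0) b
Divides-var₀ m [] _ = [] , λ ρ → trans (eval-* (suc m) (var (suc m) 0) [] ρ)
  (ℤ.*-zeroʳ (eval (suc m) (var (suc m) 0) ρ))
Divides-var₀ m (c ∷ cs) vanish = cs , λ ρ → trans (eval-* (suc m) (var (suc m) 0) cs ρ)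
  (trans (cong (ℤ._* eval (suc m) cs ρ) (eval-var (suc m) 0 ρ (s≤s z≤n)))
    (trans (sym (ℤ.+-identityˡ _)) (cong (ℤ._+ ρ 0 ℤ.* eval (suc m) cs ρ) (sym (c≡0 (ρ ∘ suc))))))
  where
  c≡0 : ∀ σ → eval m c σ ≡ 0ℤ
  c≡0 σ = trans (sym (ℤ.+-identityʳ _)) (vanish (0ℤ ▸ σ) refl)

coeff-map-applyUpTo : ∀ m (f : ℕ → P m) (g : ℕ → ℕ) {k i} → i ℕ.< k →
  U.coeff m (map f (applyUpTo g k)) i ≡ f (g i)
coeff-map-applyUpTo m f g {suc k} {zero} _ = refl
coeff-map-applyUpTo m f g {suc k} {suc i} (s≤s i<k) = coeff-map-applyUpTo m f (g ∘ suc) i<k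

coeff-map-applyUpTo-beyond : ∀ m (f : ℕ → P m) (g : ℕ → ℕ) {k i} → k ℕ.≤ i →
  U.coeff m (map f (applyUpTo g k)) i ≡ R.0# m
coeff-map-applyUpTo-beyond m f g {zero} _ = refl
coeff-map-applyUpTo-beyond m f g {suc k} {suc i} (s≤s k≤i) = coeff-map-applyUpTo-beyond m f (g ∘ suc) k≤i

eval-two-terms : ∀ m p ρ → ∃ λ r →
  eval (suc m) p ρ ≡ coeffs m p (ρ ∘ suc) 0 ℤ.+ ρ 0 ℤ.* (coeffs m p (ρ ∘ suc) 1 ℤ.+ ρ 0 ℤ.* r)
eval-two-terms m [] ρ rewrite eval-0# m (ρ ∘ suc) = 0ℤ , simplify (ρ 0)
  where
  simplify : ∀ t → 0ℤ ≡ 0ℤ ℤ.+ t ℤ.* (0ℤ ℤ.+ t ℤ.* 0ℤ)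
  simplify = solve-∀
eval-two-terms m (x ∷ []) ρ rewrite eval-0# m (ρ ∘ suc) = 0ℤ , simplify (eval m x _) (ρ 0)
  where
  simplify : ∀ x t → x ℤ.+ t ℤ.* 0ℤ ≡ x ℤ.+ t ℤ.* (0ℤ ℤ.+ t ℤ.* 0ℤ)
  simplify = solve-∀
eval-two-terms m (x ∷ y ∷ p) ρ = eval (suc m) p ρ , refl

-- If at most two coefficients were left after stripping, they would vanish at `ρ ∘ suc`, and `p`
-- would vanish at `ρ`.
degree-≥2 : ∀ m p ρ → eval (suc m) p ρ ≢ 0ℤ →
  coeffs m p (ρ ∘ suc) 0 ≡ 0ℤ → coeffs m p (ρ ∘ suc) 1 ≡ 0ℤ → ∃ λ d → U.degree m p ≡ suc (suc d)
degree-≥2 m p ρ pρ≢0 p₀≡0 p₁≡0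
  with U.strip m p | eval-strip m p ρ | (λ i → eval-coeff-strip m p i (ρ ∘ suc))
... | [] | ev | _ = ⊥-elim (pρ≢0 (sym ev))
... | x ∷ [] | ev | co = ⊥-elim (pρ≢0 (trans (sym ev)
  (cong₂ ℤ._+_ (trans (co 0) p₀≡0) (ℤ.*-zeroʳ (ρ 0)))))
... | x ∷ y ∷ [] | ev | co = ⊥-elim (pρ≢0 (trans (sym ev)
  (trans (cong₂ (λ u v → u ℤ.+ ρ 0 ℤ.* (v ℤ.+ ρ 0 ℤ.* 0ℤ)) (trans (co 0) p₀≡0) (trans (co 1) p₁≡0))
    (simplify (ρ 0)))))
  where
  simplify : ∀ t → 0ℤ ℤ.+ t ℤ.* (0ℤ ℤ.+ t ℤ.* 0ℤ) ≡ 0ℤ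
  simplify = solve-∀
... | x ∷ y ∷ z ∷ r | _ | _ = length r , refl

-- Dropping the terms of order at least two in `t` leaves a linear expression divisible by `t * t`
-- for every `t`, so both low coefficients vanish after multiplication by `σ (suc j)`. That factor
-- cancels where it is nonzero; `vanishes-off-hyperplane` covers the rest.
low-coeffs-vanish : ∀ m p j →
  (∀ t σ → σ 0 ≡ 0ℤ → t ℤ.* t ∣ σ (suc j) ℤ.* eval (suc m) p (t ▸ σ)) →
  ∀ σ → σ 0 ≡ 0ℤ → coeffs m p σ 0 ≡ 0ℤ × coeffs m p σ 1 ≡ 0ℤ
low-coeffs-vanish m p j t²∣ σ σ₀≡0 =
  vanishes-off-hyperplane m (U.coeff m p 0) j
    (λ σ σ₀≡0 σⱼ≢0 → cancel σⱼ≢0 (proj₁ (products≡0 σ σ₀≡0))) σ σ₀≡0 ,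
  vanishes-off-hyperplane m (U.coeff m p 1) j
    (λ σ σ₀≡0 σⱼ≢0 → cancel σⱼ≢0 (proj₂ (products≡0 σ σ₀≡0))) σ σ₀≡0
  where
  expand : ∀ a x t y r → a ℤ.* (x ℤ.+ t ℤ.* (y ℤ.+ t ℤ.* r)) ≡ (a ℤ.* x ℤ.+ t ℤ.* (a ℤ.* y)) ℤ.+ (a ℤ.* r) ℤ.* (t ℤ.* t)
  expand = solve-∀

  products≡0 : ∀ σ → σ 0 ≡ 0ℤ → σ (suc j) ℤ.* coeffs m p σ 0 ≡ 0ℤ × σ (suc j) ℤ.* coeffs m p σ 1 ≡ 0ℤ
  products≡0 σ σ₀≡0 = square-∣-linear (λ t →
    let r , eq = eval-two-terms m p (t ▸ σ) in
    ∣m+n∣n⇒∣m {m = σ (suc j) ℤ.* coeffs m p σ 0 ℤ.+ t ℤ.* (σ (suc j) ℤ.* coeffs m p σ 1)}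
      (subst (t ℤ.* t ∣_)
        (trans (cong (σ (suc j) ℤ.*_) eq) (expand (σ (suc j)) (coeffs m p σ 0) t (coeffs m p σ 1) r))
        (t²∣ t σ σ₀≡0))
      (∣n⇒∣m*n (σ (suc j) ℤ.* r) ∣-refl))

  cancel : ∀ {x y} → x ≢ 0ℤ → x ℤ.* y ≡ 0ℤ → y ≡ 0ℤ
  cancel {x} x≢0 eq = [ ⊥-elim ∘ x≢0 , id ]′ (ℤ.i*j≡0⇒i≡0∨j≡0 x eq)

∣-disc : ∀ m g D d → U.degree m g ≡ suc (suc d) → IsDisc m g D → ∀ {N} σ →
  coeffs m g σ (suc (suc d)) ≢ 0ℤ → N ∣ coeffs m g σ 0 → N ∣ coeffs m g σ 1 → N ∣ eval m D σ
∣-disc m g D d deg isDisc σ L≢0 N∣g₀ N∣g₁ =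
  let s , _ , eq = IsDisc⇒derivResultant m g D (suc d) deg isDisc σ
      x , N∣x , res≡ = derivResultant-leading-factor d (coeffs m g σ) N∣g₀ N∣g₁
  in ∣-cancel-factor (coeffs m g σ (suc (suc d))) s x (eval m D σ)
       (derivResultant (suc d) (coeffs m g σ)) L≢0 eq res≡ N∣x

∣-eval : ∀ m p {N} ρ σ → σ ≡ ρ [mod N ] → eval m p ρ ≡ 0ℤ → N ∣ eval m p σ
∣-eval m p {N} ρ σ σ≡ρ pρ≡0 = subst (N ∣_)
  (trans (cong (λ c → eval m p σ ℤ.- c) pρ≡0) (ℤ.+-identityʳ (eval m p σ))) (eval-mod m p σ ρ σ≡ρ)

-- The leading coefficient may vanish at `ρ`. At a congruent point `σ` where it does not, the two
-- low coefficients are divisible by the modulus, which suffices for `∣-disc`.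
disc-vanishes : ∀ m g D d → U.degree m g ≡ suc (suc d) → IsDisc m g D →
  ∀ ρ → coeffs m g ρ 0 ≡ 0ℤ → coeffs m g ρ 1 ≡ 0ℤ → eval m D ρ ≡ 0ℤ
disc-vanishes m g D d deg isDisc ρ g₀≡0 g₁≡0 = ∣-by-all⇒≡0 (λ k →
  let σ , σ≡ρ , L≢0 = leading-nonvanishing m g (suc d) deg k ρ
  in ∣-difference⇒∣ (eval-mod m D σ ρ σ≡ρ)
       (∣-disc m g D d deg isDisc σ L≢0
         (∣-eval m (U.coeff m g 0) ρ σ σ≡ρ g₀≡0) (∣-eval m (U.coeff m g 1) ρ σ σ≡ρ g₁≡0)))

-- The leading coefficient has to stay as a factor at a single point; `low-coeffs-vanish` removes it
-- by letting the linear coefficient run through all integers.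
square-∣-lead*disc : ∀ m g D d → U.degree m g ≡ suc (suc d) → IsDisc m g D → ∀ ρ → coeffs m g ρ 0 ≡ 0ℤ →
  coeffs m g ρ 1 ℤ.* coeffs m g ρ 1 ∣ coeffs m g ρ (suc (suc d)) ℤ.* eval m D ρ
square-∣-lead*disc m g D d deg isDisc ρ g₀≡0 =
  let s , _ , eq = IsDisc⇒derivResultant m g D (suc d) deg isDisc ρ
  in subst (coeffs m g ρ 1 ℤ.* coeffs m g ρ 1 ∣_) (sym eq)
       (∣n⇒∣m*n s (square-∣-derivResultant d (coeffs m g ρ) g₀≡0))

-- Serves in contrapositive form: a point with nonzero resultant shows that the discriminant is not
-- the zero polynomial.
disc≡0⇒derivResultant≡0 : ∀ m g D d → U.degree m g ≡ suc d → IsDisc m g D → ∀ ρ →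
  eval m D ρ ≡ 0ℤ → derivResultant d (coeffs m g ρ) ≡ 0ℤ
disc≡0⇒derivResultant≡0 m g D d deg isDisc ρ D≡0 =
  let s , s≢0 , eq = IsDisc⇒derivResultant m g D d deg isDisc ρ
  in [ ⊥-elim ∘ s≢0 , id ]′ (ℤ.i*j≡0⇒i≡0∨j≡0 s (trans (sym eq)
       (trans (cong (coeffs m g ρ (suc d) ℤ.*_) D≡0) (ℤ.*-zeroʳ (coeffs m g ρ (suc d))))))

-- The generic polynomial and its discriminant

module _ (e : ℕ) where
  private n = suc (suc e)

  aIndex-< : ∀ {i} → i ℕ.≤ n → aIndex i ℕ.< suc n
  aIndex-< {zero} _ = s≤s (s≤s z≤n)
  aIndex-< {suc zero} _ = s≤s z≤n
  aIndex-< {suc (suc i)} i≤n = s≤s i≤n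

  genericCoeffs : (ℕ → ℤ) → ℕ → ℤ
  genericCoeffs = coeffs (suc n) (genericPoly n)

  genericCoeffs-≤ : ∀ ρ i → i ℕ.≤ n → genericCoeffs ρ i ≡ ρ (aIndex i)
  genericCoeffs-≤ ρ i i≤n = trans
    (cong (λ c → eval (suc n) c ρ) (coeff-map-applyUpTo (suc n) (a n) id (s≤s i≤n)))
    (eval-var (suc n) (aIndex i) ρ (aIndex-< i≤n))

  genericCoeffs-> : ∀ ρ i → n ℕ.< i → genericCoeffs ρ i ≡ 0ℤ
  genericCoeffs-> ρ i n<i = trans
    (cong (λ c → eval (suc n) c ρ) (coeff-map-applyUpTo-beyond (suc n) (a n) id n<i)) (eval-0# (suc n) ρ)

  degree-generic : U.degree (suc n) (genericPoly n) ≡ n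
  degree-generic = degree-≡ (suc n) (genericPoly n) n (λ _ → 1ℤ)
    (λ eq → +suc≢0 (trans (sym (genericCoeffs-≤ (λ _ → 1ℤ) n ℕ.≤-refl)) eq))
    (λ i n<i ρ → genericCoeffs-> ρ i n<i)

module _ (e : ℕ) (D : P (suc (suc (suc e))))
         (isDisc : IsDisc (suc (suc (suc e))) (genericPoly (suc (suc e))) D) where
  private
    n = suc (suc e)
    top = genericCoeffs-≤ e

  -- In `t ▸ σ` the value of a₁ is `t`, that of a₀ is `σ 0`, and that of aₙ is `σ (suc e)`.
  square-∣-disc : ∀ t σ → σ 0 ≡ 0ℤ → t ℤ.* t ∣ σ (suc e) ℤ.* eval (suc n) D (t ▸ σ)
  square-∣-disc t σ σ₀≡0 = subst₂ _∣_
    (cong₂ ℤ._*_ (top (t ▸ σ) 1 (s≤s z≤n)) (top (t ▸ σ) 1 (s≤s z≤n)))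
    (cong (ℤ._* eval (suc n) D (t ▸ σ)) (top (t ▸ σ) n ℕ.≤-refl))
    (square-∣-lead*disc (suc n) (genericPoly n) D e (degree-generic e) isDisc (t ▸ σ)
      (trans (top (t ▸ σ) 0 z≤n) σ₀≡0))

  low-coeffs : ∀ σ → σ 0 ≡ 0ℤ → coeffs n D σ 0 ≡ 0ℤ × coeffs n D σ 1 ≡ 0ℤ
  low-coeffs = low-coeffs-vanish n D e square-∣-disc

  -- The generic polynomial becomes xⁿ + x here.
  point : ℕ → ℤ
  point = 1ℤ ▸ update (λ _ → 0ℤ) (suc e) 1ℤ

  -- Otherwise the resultant at `point` would be zero, while it is 1 modulo `n`; then `n`, which is
  -- at least 2, would divide -1.
  disc-point≢0 : eval (suc n) D point ≢ 0ℤ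
  disc-point≢0 D≡0 =
    ℕ.<⇒≱ {1} {n} (s≤s (s≤s z≤n)) (∣ℕ⇒≤ (∣⇒∣ᵤ (subst (λ x → + n ∣ x ℤ.- 1ℤ)
      (disc≡0⇒derivResultant≡0 (suc n) (genericPoly n) D (suc e) (degree-generic e) isDisc point D≡0)
      (derivResultant-mod-degree (suc e) f (top point 1 (s≤s z≤n))
        (trans (top point n ℕ.≤-refl) (update-at (λ _ → 0ℤ) (suc e) 1ℤ)) n∣f′))))
    where
    f = genericCoeffs e point

    n∣f′ : ∀ j → + n ∣ derivℤ f (suc j)
    -- The entry is `+ suc (suc j) * f (suc (suc j))`. The coefficient is zero unless `j` is `e`,
    -- and in that case the integer factor is `n`.
    n∣f′ j with ℕ.<-cmp j e
    ... | tri< j<e j≢e _ = ∣n⇒∣m*n (+ suc (suc j)) (subst (+ n ∣_) (sym (trans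
      (top point (suc (suc j)) (s≤s (s≤s (ℕ.<⇒≤ j<e))))
      (update-other (λ _ → 0ℤ) (suc e) 1ℤ (suc j) (j≢e ∘ ℕ.suc-injective)))) ∣0)
    ... | tri≈ _ refl _ = ∣m⇒∣m*n (f n) ∣-refl
    ... | tri> _ _ e<j = ∣n⇒∣m*n (+ suc (suc j))
      (subst (+ n ∣_) (sym (genericCoeffs-> e point (suc (suc j)) (s≤s (s≤s e<j)))) ∣0)

  doubleDisc-vanishes : ∀ DD → IsDisc n D DD → ∀ ρ → ρ 0 ≡ 0ℤ → eval n DD ρ ≡ 0ℤ
  doubleDisc-vanishes DD isDD ρ ρ₀≡0 =
    -- At `point` a₀ is 0, so this one point shows that the degree of `D` in a₁ is at least 2. The
    -- low coefficients are then taken at the given `ρ`.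
    let d₀≡0 , d₁≡0 = low-coeffs (point ∘ suc) refl
        d , deg = degree-≥2 n D point disc-point≢0 d₀≡0 d₁≡0
        c₀≡0 , c₁≡0 = low-coeffs ρ ρ₀≡0
    in disc-vanishes n D DD d deg isDD ρ c₀≡0 c₁≡0

theorem4p1 : ∀ (n : ℕ) → 2 ≤ n →
    ∀ (Dn : P (suc n)) → IsDisc (suc n) (genericPoly n) Dn →
    ∀ (DDn1 : P n) → IsDisc n Dn DDn1 →
    Divides n (a₀ᴿ n) DDn1
theorem4p1 (suc (suc e)) (s≤s (s≤s _)) Dn isDn DDn1 isDDn1 =
  Divides-var₀ (suc e) DDn1 (doubleDisc-vanishes e Dn isDn DDn1 isDDn1)
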